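{- Let $G=(V,E)$ be a directed graph whose chromatic number is finite. Then $G\in\mathfrak{Out}_2$, i.e. there is an independent set $A\subseteq V$ such that for each $v\in V$ there is a directed path of length at most $2$ from some point of $A$ to $v$.
   Context: Digraphs $G=(V,E)$, $E\subseteq V\times V$, may be infinite. A set $A\subseteq V$ is independent if there is no edge (in either direction) between two distinct elements of $A$. Paths of length $0$ are allowed. The chromatic number of $G$ is the least number of independent sets into which $V$ can be partitioned (i.e. the chromatic number of the underlying undirected graph). -}

module Defs where

open import Data.Fin.Base using (Fin)
open import Data.List.Base using (List; []; _∷_)
open import Data.List.Relation.Unary.Unique.Propositional using (Unique)
open import Data.Nat.Base using (ℕ; zero; suc; _≤_)
open import Data.Product.Base using (Σ-syntax; ∃-syntax; _×_)
open import Function.Definitions using (StrictlySurjective)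
open import Level using (Level; _⊔_) renaming (suc to lsuc)
open import Relation.Binary.Core using (Rel)
open import Relation.Binary.Construct.Closure.ReflexiveTransitive using (Star; ε; _◅_)
open import Relation.Binary.PropositionalEquality.Core using (_≡_; _≢_)
open import Relation.Nullary.Negation.Core using (¬_)
open import Relation.Unary using (Pred; _∈_)

-- Possibly infinite; loops and pairs of opposite edges are allowed.
record Digraph (a e : Level) : Set (lsuc (a ⊔ e)) where
  field
    V : Set a
    E : Rel V e

module _ {a e : Level} (G : Digraph a e) where
  open Digraph G

  -- Both directions are excluded, since u and v may be exchanged.
  Independent : ∀ {ℓ} → Pred V ℓ → Set (a ⊔ e ⊔ ℓ)
  Independent A = ∀ {u v} → u ∈ A → v ∈ A → u ≢ v → ¬ E u v

  -- The sets of the partition are the fibres of part; surjectivity says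
  -- that none of them is empty.
  record IndependentPartition (n : ℕ) : Set (a ⊔ e) where
    field
      part        : V → Fin n
      nonempty    : StrictlySurjective _≡_ part
      independent : ∀ i → Independent (λ v → part v ≡ i)

  IsChromaticNumber : ℕ → Set (a ⊔ e)
  IsChromaticNumber n =
    IndependentPartition n × (∀ m → IndependentPartition m → n ≤ m)

  FiniteChromaticNumber : Set (a ⊔ e)
  FiniteChromaticNumber = ∃[ n ] IsChromaticNumber n

  vertices : ∀ {u v} → Star E u v → List V
  vertices {u} ε       = u ∷ []
  vertices {u} (_ ◅ p) = u ∷ vertices p

  length : ∀ {u v} → Star E u v → ℕ
  length ε       = zero
  length (_ ◅ p) = suc (length p)

  -- Star E gives directed walks; a path does not repeat a vertex.
  PathOfLength≤ : ℕ → V → V → Set (a ⊔ e)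
  PathOfLength≤ n u v = Σ[ p ∈ Star E u v ] (Unique (vertices p) × length p ≤ n)

  Out : ℕ → Set (lsuc (a ⊔ e))
  Out n = Σ[ A ∈ Pred V (a ⊔ e) ]
    (Independent A × (∀ v → ∃[ u ] (u ∈ A × PathOfLength≤ n u v)))

{-# OPTIONS --safe #-}

-- A well-founded relation R has a kernel: declare v a member when none of its
-- R-predecessors is one. Number the colour classes. The edges going up in
-- colour are well-founded and have a kernel K; the edges going down in colour
-- that start in K are well-founded too and have a kernel L. Then K ∩ L is
-- independent, reaches every vertex of K in at most one step, and so reaches
-- every vertex in at most two.
module Submission where

open import Level using (Level; _⊔_)
open import Axiom.ExcludedMiddle using (ExcludedMiddle)
open import Defs

open import Data.Fin.Base using (_<_; _>_)
open import Data.Fin.Induction using (<-wellFounded; >-wellFounded)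
open import Data.Fin.Properties using (<-cmp; <-irrefl)
open import Data.List.Relation.Unary.All using ([]; _∷_)
open import Data.List.Relation.Unary.AllPairs using ([]; _∷_)
open import Data.Nat.Base using (z≤n; s≤s)
open import Data.Product.Base using (Σ-syntax; ∃-syntax; _×_; _,_; proj₂)
open import Data.Sum.Base using (_⊎_; inj₁; inj₂)
open import Induction.WellFounded using (Acc; acc; WellFounded; module Subrelation)
open import Relation.Binary.Core using (Rel)
open import Relation.Binary.Construct.Closure.ReflexiveTransitive using (ε; _◅_)
import Relation.Binary.Construct.On as On
open import Relation.Binary.Definitions using (tri<; tri≈; tri>)
open import Relation.Binary.PropositionalEquality.Core using (_≢_; refl; sym; cong)
open import Relation.Nullary.Decidable.Core using (yes; no)
open import Relation.Nullary.Negation.Core using (¬_)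
open import Relation.Unary using (Pred; _∈_; _∩_)

module _ {a r} {V : Set a} (R : Rel V r) where

  IsKernel : ∀ {ℓ} → Pred V ℓ → Set (a ⊔ r ⊔ ℓ)
  IsKernel K = (∀ {u v} → u ∈ K → v ∈ K → ¬ R u v)
             × (∀ v → v ∈ K ⊎ ∃[ u ] (u ∈ K × R u v))

  private
    -- The defining condition refers to itself negatively, so it cannot be an inductive type;
    -- recursion on accessibility replaces it.
    Member : ∀ {v} → Acc R v → Set (a ⊔ r)
    Member {v} (acc rs) = ∀ {u} (Ruv : R u v) → ¬ Member (rs Ruv)

    -- Frees membership from the choice of accessibility proof. The negation reverses the direction,
    -- hence `p` and `q` trade places in the recursive call.
    Member-irrelevant : ∀ {v} (p q : Acc R v) → Member p → Member q
    Member-irrelevant (acc ps) (acc qs) m Ruv mq =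
      m Ruv (Member-irrelevant (qs Ruv) (ps Ruv) mq)

  wellFounded⇒kernel : ExcludedMiddle (a ⊔ r) → WellFounded R →
                       Σ[ K ∈ Pred V (a ⊔ r) ] IsKernel K
  wellFounded⇒kernel em wf = K , independent , absorbing
    where
    K : Pred V (a ⊔ r)
    K v = Member (wf v)

    unfold : ∀ {v} (p : Acc R v) → Member p → ∀ {u} → R u v → ¬ u ∈ K
    unfold (acc ps) m {u} Ruv k = m Ruv (Member-irrelevant (wf u) (ps Ruv) k)

    fold : ∀ {v} (p : Acc R v) → (∀ {u} → R u v → ¬ u ∈ K) → Member p
    fold (acc ps) h {u} Ruv m = h Ruv (Member-irrelevant (ps Ruv) (wf u) m)

    independent : ∀ {u v} → u ∈ K → v ∈ K → ¬ R u v
    independent {v = v} ku kv Ruv = unfold (wf v) kv Ruv ku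

    absorbing : ∀ v → v ∈ K ⊎ ∃[ u ] (u ∈ K × R u v)
    -- Excluded middle is used only to decide whether `v` has a predecessor in `K`.
    absorbing v with em {∃[ u ] (u ∈ K × R u v)}
    ... | yes pred  = inj₂ pred
    ... | no  ¬pred = inj₁ (fold (wf v) λ Ruv ku → ¬pred (_ , ku , Ruv))

module _ {a e} (G : Digraph a e) where
  open Digraph G

  path₀ : ∀ {n} v → PathOfLength≤ G n v v
  path₀ v = ε , [] ∷ [] , z≤n

  path₁ : ∀ {u v} → u ≢ v → E u v → PathOfLength≤ G 2 u v
  path₁ u≢v uv = uv ◅ ε , (u≢v ∷ []) ∷ [] ∷ [] , s≤s z≤n

  path₂ : ∀ {u w v} → u ≢ w → w ≢ v → u ≢ v → E u w → E w v → PathOfLength≤ G 2 u v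
  path₂ u≢w w≢v u≢v uw wv =
    uw ◅ wv ◅ ε , (u≢w ∷ u≢v ∷ []) ∷ (w≢v ∷ []) ∷ [] ∷ [] , s≤s (s≤s z≤n)

  independentPartition⇒Out₂ : ∀ {n} → ExcludedMiddle (a ⊔ e) →
                              IndependentPartition G n → Out G 2
  independentPartition⇒Out₂ em P
    with wellFounded⇒kernel Up em up-wf
    where
    open IndependentPartition P

    Up : Rel V e
    Up u v = E u v × part u < part v

    up-wf : WellFounded Up
    up-wf = Subrelation.wellFounded proj₂ (On.wellFounded part <-wellFounded)
  ... | K , K-indep , K-absorb
    with wellFounded⇒kernel Down em down-wf
    where
    open IndependentPartition P

    -- Only the source must lie in `K`: a predecessor supplied by the kernel `L` is then in `K ∩ L`.
    Down : Rel V (a ⊔ e)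
    Down u v = u ∈ K × E u v × part u > part v

    -- Relies on there being finitely many colours: predecessors have ever larger colours.
    down-wf : WellFounded Down
    down-wf = Subrelation.wellFounded (λ (_ , _ , gt) → gt)
                (On.wellFounded part >-wellFounded)
  ... | L , L-indep , L-absorb = K ∩ L , indep , reach
    where
    open IndependentPartition P

    indep : Independent G (K ∩ L)
    -- An edge inside `K ∩ L` would go up, contradicting `K`, stay in one colour class, or go down
    -- from a vertex of `K`, contradicting `L`.
    indep {u} {v} (ku , lu) (kv , lv) u≢v uv with <-cmp (part u) (part v)
    ... | tri< lt _ _ = K-indep ku kv (uv , lt)
    ... | tri≈ _ eq _ = independent (part v) eq refl u≢v uv
    ... | tri> _ _ gt = L-indep lu lv (ku , uv , gt)

    <⇒≢ : ∀ {u v} → part u < part v → u ≢ v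
    <⇒≢ lt eq = <-irrefl (cong part eq) lt

    >⇒≢ : ∀ {u v} → part u > part v → u ≢ v
    >⇒≢ gt eq = <⇒≢ gt (sym eq)

    reach : ∀ v → ∃[ u ] (u ∈ K ∩ L × PathOfLength≤ G 2 u v)
    reach v with K-absorb v
    reach v | inj₁ kv with L-absorb v
    ... | inj₁ lv                      = v , (kv , lv) , path₀ v
    ... | inj₂ (u , lu , ku , uv , gt) = u , (ku , lu) , path₁ (>⇒≢ gt) uv
    reach v | inj₂ (w , kw , wv , lt) with L-absorb w
    ... | inj₁ lw                      = w , (kw , lw) , path₁ (<⇒≢ lt) wv
    ... | inj₂ (u , lu , ku , uw , gt) =
      u , (ku , lu) , path₂ (>⇒≢ gt) (<⇒≢ lt) u≢v uw wv
      where
      u≢v : u ≢ v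
      -- If the walk returned to its start, `v` would be in `K`, yet the upward edge to it from `w`
      -- also starts in `K`.
      u≢v refl = K-indep kw ku (wv , lt)

corollary2p4 : ∀ {a e : Level} → ExcludedMiddle (a ⊔ e) →
    (G : Digraph a e) → FiniteChromaticNumber G → Out G 2
corollary2p4 em G (_ , P , _) = independentPartition⇒Out₂ G em P
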